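{- Let $E$ be an elliptic curve over a finite field $\mathbb{F}_q$ with equation $y^2+a_1xy+a_3y=x^3$, where $a_1,a_3\in\mathbb{F}_q$. (1) If $a_3$ is a cube in $\mathbb{F}_q$, then $E$ is isomorphic over $\mathbb{F}_q$ to a curve of the form $y^2+axy+y=x^3$ with $a\in\mathbb{F}_q$. (2) If $a_3$ is not a cube in $\mathbb{F}_q$ and $b_0\in\mathbb{F}_q$ is a fixed non-cube, then $E$ is isomorphic over $\mathbb{F}_q$ to a curve of the form $y^2+axy+b_0y=x^3$ or $y^2+axy+b_0^2y=x^3$ with $a\in\mathbb{F}_q$. Moreover, if $q\equiv -1 \pmod 3$, every elliptic curve over $\mathbb{F}_q$ with an $\mathbb{F}_q$-rational point of order $3$ admits, up to isomorphism over $\mathbb{F}_q$, an equation of the form $y^2+axy+y=x^3$ with $a\in\mathbb{F}_q$. -}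

module Defs where

open import Algebra.Bundles using (CommutativeRing)
open import Algebra.Definitions using (Invertible)
open import Data.Fin using (Fin)
import Data.Fin.Properties as Fin
open import Data.Nat using (ℕ; zero; suc; _<_)
open import Data.Product using (∃; _×_; _,_; proj₁)
open import Data.Unit.Polymorphic using (⊤)
open import Function.Bundles using (Inverse)
open import Function.Properties.Inverse using (Inverse⇒Injection)
open import Level using (_⊔_) renaming (suc to lsuc)
open import Relation.Binary.Definitions using (Decidable)
import Relation.Binary.PropositionalEquality as ≡
open import Relation.Nullary using (yes; no)
open import Relation.Nullary.Decidable using (via-injection)

import Algebra.Properties.Semiring.Exp as Exp
import Algebra.Properties.Semiring.Mult as Mult

record FiniteField c ℓ (q : ℕ) : Set (lsuc (c ⊔ ℓ)) where
  field
    commutativeRing : CommutativeRing c ℓ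

  open CommutativeRing commutativeRing public

  field
    1≉0          : 1# ≉ 0#
    ≉0⇒invertible : ∀ x → x ≉ 0# → Invertible _≈_ 1# _*_ x
    enumeration  : Inverse setoid (≡.setoid (Fin q))

  infix 4 _≟_
  _≟_ : Decidable _≈_
  _≟_ = via-injection (Inverse⇒Injection enumeration) Fin._≟_

  -- Totalised by 0⁻¹ = 0.
  infix 9 _⁻¹
  _⁻¹ : Carrier → Carrier
  x ⁻¹ with x ≟ 0#
  ... | yes _  = 0#
  ... | no x≉0 = proj₁ (≉0⇒invertible x x≉0)

module Weierstrass {c ℓ} {q : ℕ} (K : FiniteField c ℓ q) where

  open FiniteField K public
  open Exp semiring public using (_^_)
  open Mult semiring public using () renaming (_×_ to infixr 8 _·_)

  IsCube : Carrier → Set (c ⊔ ℓ)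
  IsCube x = ∃ λ y → y ^ 3 ≈ x

  -- y² + a₁xy + a₃y = x³ + a₂x² + a₄x + a₆
  record WeierstrassCurve : Set c where
    constructor weierstrass
    field
      a₁ a₂ a₃ a₄ a₆ : Carrier

    b₂ b₄ b₆ b₈ Δ : Carrier
    b₂ = a₁ ^ 2 + 4 · a₂
    b₄ = 2 · a₄ + a₁ * a₃
    b₆ = a₃ ^ 2 + 4 · a₆
    b₈ = a₁ ^ 2 * a₆ + 4 · (a₂ * a₆) - a₁ * a₃ * a₄ + a₂ * a₃ ^ 2 - a₄ ^ 2
    Δ  = 9 · (b₂ * b₄ * b₆) - b₂ ^ 2 * b₈ - 8 · b₄ ^ 3 - 27 · b₆ ^ 2

  IsElliptic : WeierstrassCurve → Set ℓ
  IsElliptic E = WeierstrassCurve.Δ E ≉ 0#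

  y²+_xy+_y=x³ : Carrier → Carrier → WeierstrassCurve
  y²+ a xy+ b y=x³ = weierstrass a 0# b 0# 0#

  -- Isomorphism over K fixing the point at infinity: the substitution
  -- x = u²x′ + r, y = u³y′ + su²x′ + t turns the equation of E into u⁶ times
  -- that of E′.
  infix 4 _≅_
  record _≅_ (E E′ : WeierstrassCurve) : Set (c ⊔ ℓ) where
    open WeierstrassCurve E
    open WeierstrassCurve E′ using ()
      renaming (a₁ to a₁′; a₂ to a₂′; a₃ to a₃′; a₄ to a₄′; a₆ to a₆′)
    field
      u r s t : Carrier
      u≉0 : u ≉ 0#
      a₁-eq : u * a₁′ ≈ a₁ + 2 · s
      a₂-eq : u ^ 2 * a₂′ ≈ a₂ - s * a₁ + 3 · r - s ^ 2
      a₃-eq : u ^ 3 * a₃′ ≈ a₃ + r * a₁ + 2 · t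
      a₄-eq : u ^ 4 * a₄′ ≈
        a₄ - s * a₃ + 2 · (r * a₂) - (t + r * s) * a₁ + 3 · r ^ 2 - 2 · (s * t)
      a₆-eq : u ^ 6 * a₆′ ≈
        a₆ + r * a₄ + r ^ 2 * a₂ + r ^ 3 - t * a₃ - t ^ 2 - r * t * a₁

  data Point : Set c where
    𝒪      : Point
    affine : (x y : Carrier) → Point

  module _ (E : WeierstrassCurve) where
    open WeierstrassCurve E

    OnCurve : Point → Set ℓ
    OnCurve 𝒪            = ⊤
    OnCurve (affine x y) =
      y ^ 2 + a₁ * x * y + a₃ * y ≈ x ^ 3 + a₂ * x ^ 2 + a₄ * x + a₆

    -- The third point on the line of slope λ′ through (x₁ , y₁) and a point
    -- with abscissa x₂, reflected by (x , y) ↦ (x , - y - a₁x - a₃).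
    thirdPoint : (λ′ x₁ y₁ x₂ : Carrier) → Point
    thirdPoint λ′ x₁ y₁ x₂ = affine x₃ (- (λ′ * (x₃ - x₁) + y₁) - a₁ * x₃ - a₃)
      where
      x₃ : Carrier
      x₃ = λ′ ^ 2 + a₁ * λ′ - a₂ - x₁ - x₂

    -- The chord-and-tangent law, meaningful for points satisfying OnCurve.
    -- For such points, the last case occurs only when y₁ ≈ y₂ and the
    -- denominator of the tangent slope is nonzero.
    add : Point → Point → Point
    add 𝒪              Q              = Q
    add P@(affine _ _) 𝒪              = P
    add (affine x₁ y₁) (affine x₂ y₂) with x₁ ≟ x₂ | y₁ + y₂ + a₁ * x₂ + a₃ ≟ 0#
    ... | no  _ | _     = thirdPoint ((y₂ - y₁) * (x₂ - x₁) ⁻¹) x₁ y₁ x₂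
    ... | yes _ | yes _ = 𝒪
    ... | yes _ | no  _ = thirdPoint
      ((3 · x₁ ^ 2 + 2 · (a₂ * x₁) + a₄ - a₁ * y₁)
        * (2 · y₁ + a₁ * x₁ + a₃) ⁻¹)
      x₁ y₁ x₂

    multiple : ℕ → Point → Point
    multiple zero    P = 𝒪
    multiple (suc n) P = add P (multiple n P)

    HasOrder : Point → ℕ → Set c
    HasOrder P n = 0 < n × multiple n P ≡.≡ 𝒪
      × (∀ m → 0 < m → m < n → multiple m P ≡.≢ 𝒪)

module Submission where

-- A curve with third coefficient u³b rescales to one with third coefficient b,
-- so (1) and (2) come down to the cosets of the cubes in K*.  If cubing is not
-- injective, K contains a primitive cube root of unity ω, and x is determined
-- by x³ and the j for which x is ωʲ times a chosen cube root of x³; if cubing is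
-- injective, j = 0 serves.  For a
-- non-cube b the cosets bⁱK*³ with i = 0, 1, 2 are disjoint, so
-- (i , x) ↦ (j , bⁱx³) is an injective self-map of the finite set
-- {0,1,2} × K; it is therefore surjective, and the three cosets cover K*.
--
-- If q + 1 = 3k, Fermat gives a · (a^(k-1))³ = a^(q-1) = 1, so every element is
-- a cube.  For a point P of order 3, x(2P) = x(P) is exactly the vanishing of
-- a₂ once P is at the origin with tangent y = 0.

open import Defs
open import Algebra.Bundles using (CommutativeRing)
open import Data.Nat as ℕ using (ℕ)
open import Data.Nat.Divisibility using (_∣_; divides)
open import Data.Product using (∃; _×_)
open import Data.Sum using (_⊎_)
open import Relation.Nullary using (¬_)

open import Algebra.Solver.Ring.AlmostCommutativeRing
  using (_-Raw-AlmostCommutative⟶_; fromCommutativeRing)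
open import Data.Empty using (⊥-elim)
open import Data.Fin using (Fin; zero; suc; toℕ; combine; remQuot; punchIn)
open import Data.Fin.Permutation
  using (Permutation; permutation; remove; punchIn-permute; _⟨$⟩ʳ_)
open import Data.Fin.Properties
  using (any?; punchInᵢ≢i; punchOut-injective; <⇒notInjective; remQuot-combine; combine-remQuot)
  renaming (_≟_ to _≟ᶠ_)
open import Data.Integer as ℤ using (ℤ; +_; -[1+_]; _◃_; _⊖_)
import Data.Integer.Properties as ℤ
open import Data.Maybe using (Maybe; just; nothing)
import Data.Nat.Properties as ℕ
open import Data.Product using (_,_; proj₁; proj₂; map₂)
open import Data.Product.Relation.Binary.Pointwise.NonDependent using (_×ₛ_)
import Data.Sign as Sign
open import Data.Sum using (inj₁; inj₂; [_,_]′; fromInj₂)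
open import Function using (_∘_; case_of_; Injective; Inverse)
open import Relation.Binary using (Setoid)
open import Relation.Binary.PropositionalEquality as ≡ using (_≡_)
open import Relation.Nullary using (yes; no; contradiction)
open import Relation.Nullary.Decidable using (_×-dec_; ¬?)

-- A ring solver with integer coefficients over a commutative ring.

module IntegerCoefficients {c ℓ} (R : CommutativeRing c ℓ) where

  open CommutativeRing R
  open import Algebra.Properties.AbelianGroup +-abelianGroup using (⁻¹-∙-comm)
  open import Algebra.Properties.Group +-group using (ε⁻¹≈ε; ⁻¹-involutive)
  open import Algebra.Properties.Ring ring using (-‿distribˡ-*; -‿distribʳ-*)
  open import Algebra.Properties.CommutativeSemigroup +-commutativeSemigroup using (interchange)
  open import Algebra.Properties.Semiring.Mult.TCOptimised semiring
    using (1+×; ×-homo-+; ×1-homo-*) renaming (_×_ to _·_)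
  open import Relation.Binary.Reasoning.Setoid setoid

  -- With the optimised multiple, `1 · 1#` reduces to `1#`, so the solver constant `con (+ 1)`
  -- matches `1#` definitionally.
  ⟦_⟧ : ℤ → Carrier
  ⟦ + n ⟧      = n · 1#
  ⟦ -[1+ n ] ⟧ = - (ℕ.suc n · 1#)

  ⟦-◃⟧ : ∀ n → ⟦ Sign.- ◃ n ⟧ ≈ - (n · 1#)
  ⟦-◃⟧ ℕ.zero    = sym ε⁻¹≈ε
  ⟦-◃⟧ (ℕ.suc n) = refl

  ⟦⊖⟧ : ∀ m n → ⟦ m ⊖ n ⟧ ≈ m · 1# - n · 1#
  ⟦⊖⟧ m         ℕ.zero    = sym (trans (+-congˡ ε⁻¹≈ε) (+-identityʳ _))
  ⟦⊖⟧ ℕ.zero    (ℕ.suc n) = sym (+-identityˡ _)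
  ⟦⊖⟧ (ℕ.suc m) (ℕ.suc n) = begin
    ⟦ ℕ.suc m ⊖ ℕ.suc n ⟧                  ≡⟨ ≡.cong ⟦_⟧ (ℤ.[1+m]⊖[1+n]≡m⊖n m n) ⟩
    ⟦ m ⊖ n ⟧                              ≈⟨ ⟦⊖⟧ m n ⟩
    m · 1# - n · 1#                        ≈⟨ +-identityˡ _ ⟨
    0# + (m · 1# - n · 1#)                 ≈⟨ +-congʳ (-‿inverseʳ 1#) ⟨
    (1# - 1#) + (m · 1# - n · 1#)          ≈⟨ interchange _ _ _ _ ⟩
    (1# + m · 1#) + (- 1# + - (n · 1#))    ≈⟨ +-congˡ (⁻¹-∙-comm _ _) ⟩
    (1# + m · 1#) - (1# + n · 1#)          ≈⟨ +-cong (1+× m 1#) (-‿cong (1+× n 1#)) ⟨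
    ℕ.suc m · 1# - ℕ.suc n · 1#            ∎

  +-homo : ∀ i j → ⟦ i ℤ.+ j ⟧ ≈ ⟦ i ⟧ + ⟦ j ⟧
  +-homo (+ m)    (+ n)    = ×-homo-+ 1# m n
  +-homo (+ m)    -[1+ n ] = ⟦⊖⟧ m (ℕ.suc n)
  +-homo -[1+ m ] (+ n)    = trans (⟦⊖⟧ n (ℕ.suc m)) (+-comm _ _)
  +-homo -[1+ m ] -[1+ n ] = begin
    - (ℕ.suc (ℕ.suc (m ℕ.+ n)) · 1#)     ≡⟨ ≡.cong (λ k → - (ℕ.suc k · 1#)) (ℕ.+-suc m n) ⟨
    - ((ℕ.suc m ℕ.+ ℕ.suc n) · 1#)       ≈⟨ -‿cong (×-homo-+ 1# (ℕ.suc m) (ℕ.suc n)) ⟩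
    - (ℕ.suc m · 1# + ℕ.suc n · 1#)      ≈⟨ ⁻¹-∙-comm _ _ ⟨
    - (ℕ.suc m · 1#) - (ℕ.suc n · 1#)    ∎

  *-homo : ∀ i j → ⟦ i ℤ.* j ⟧ ≈ ⟦ i ⟧ * ⟦ j ⟧
  *-homo (+ m) (+ n) = begin
    ⟦ + m ℤ.* + n ⟧       ≡⟨ ≡.cong ⟦_⟧ (ℤ.pos-* m n) ⟨
    (m ℕ.* n) · 1#        ≈⟨ ×1-homo-* m n ⟩
    m · 1# * n · 1#       ∎
  *-homo (+ m) -[1+ n ] = begin
    ⟦ Sign.- ◃ (m ℕ.* ℕ.suc n) ⟧   ≈⟨ ⟦-◃⟧ (m ℕ.* ℕ.suc n) ⟩
    - ((m ℕ.* ℕ.suc n) · 1#)       ≈⟨ -‿cong (×1-homo-* m (ℕ.suc n)) ⟩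
    - (m · 1# * ℕ.suc n · 1#)      ≈⟨ -‿distribʳ-* _ _ ⟩
    m · 1# * - (ℕ.suc n · 1#)      ∎
  *-homo -[1+ m ] (+ n) = begin
    ⟦ Sign.- ◃ (ℕ.suc m ℕ.* n) ⟧   ≈⟨ ⟦-◃⟧ (ℕ.suc m ℕ.* n) ⟩
    - ((ℕ.suc m ℕ.* n) · 1#)       ≈⟨ -‿cong (×1-homo-* (ℕ.suc m) n) ⟩
    - (ℕ.suc m · 1# * n · 1#)      ≈⟨ -‿distribˡ-* _ _ ⟩
    - (ℕ.suc m · 1#) * n · 1#      ∎
  *-homo -[1+ m ] -[1+ n ] = begin
    (ℕ.suc m ℕ.* ℕ.suc n) · 1#              ≈⟨ ×1-homo-* (ℕ.suc m) (ℕ.suc n) ⟩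
    ℕ.suc m · 1# * ℕ.suc n · 1#             ≈⟨ ⁻¹-involutive _ ⟨
    - - (ℕ.suc m · 1# * ℕ.suc n · 1#)       ≈⟨ -‿cong (-‿distribˡ-* _ _) ⟩
    - (- (ℕ.suc m · 1#) * ℕ.suc n · 1#)     ≈⟨ -‿distribʳ-* _ _ ⟩
    - (ℕ.suc m · 1#) * - (ℕ.suc n · 1#)     ∎

  -‿homo : ∀ i → ⟦ ℤ.- i ⟧ ≈ - ⟦ i ⟧
  -‿homo (+ ℕ.zero)  = sym ε⁻¹≈ε
  -‿homo (+ ℕ.suc n) = refl
  -‿homo -[1+ n ]    = sym (⁻¹-involutive _)

  homomorphism : ℤ.+-*-rawRing -Raw-AlmostCommutative⟶ fromCommutativeRing R
  homomorphism = record
    { ⟦_⟧    = ⟦_⟧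
    ; +-homo = +-homo
    ; *-homo = *-homo
    ; -‿homo = -‿homo
    ; 0-homo = refl
    ; 1-homo = refl
    }

  ⟦_⟧≟⟦_⟧ : ∀ i j → Maybe (⟦ i ⟧ ≈ ⟦ j ⟧)
  ⟦ i ⟧≟⟦ j ⟧ with i ℤ.≟ j
  ... | yes i≡j = just (reflexive (≡.cong ⟦_⟧ i≡j))
  ... | no  _   = nothing

  open import Algebra.Solver.Ring _ _ homomorphism ⟦_⟧≟⟦_⟧ public
    using (Polynomial; solve; _:=_; _:+_; _:*_; _:-_; _:^_; _:×_; con)

-- The pigeonhole principle, for `Fin n` and for finite setoids.

-- If `j` were missed, punching it out of the codomain would leave an injection of `suc n` elements
-- into `n`.
finite-injective⇒surjective : ∀ {n} {f : Fin n → Fin n} →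
  Injective _≡_ _≡_ f → ∀ j → ∃ λ i → f i ≡ j
finite-injective⇒surjective {ℕ.suc n} {f} inj j with any? (λ i → f i ≟ᶠ j)
... | yes hit = hit
... | no miss = ⊥-elim
  (<⇒notInjective (ℕ.n<1+n n) (inj ∘ punchOut-injective (avoids _) (avoids _)))
  where
  avoids : ∀ i → j ≡.≢ f i
  avoids i j≡fi = miss (i , ≡.sym j≡fi)

module _ {a ℓ} {S : Setoid a ℓ} {n} (count : Inverse S (≡.setoid (Fin n))) where

  open Setoid S
  open Inverse count

  injective⇒surjective : ∀ {f : Carrier → Carrier} →
    Injective _≈_ _≈_ f → ∀ y → ∃ λ x → f x ≈ y
  injective⇒surjective {f} f-injective y =
    let i , toffromi≡toy = finite-injective⇒surjective injective (to y)
    in from i , to-injective toffromi≡toy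
    where
    to-injective : ∀ {x x′} → to x ≡ to x′ → x ≈ x′
    to-injective {x} {x′} eq =
      trans (sym (strictlyInverseʳ x)) (trans (from-cong eq) (strictlyInverseʳ x′))

    injective : Injective _≡_ _≡_ (to ∘ f ∘ from)
    injective {i} {j} eq = ≡.trans (≡.sym (strictlyInverseˡ i))
      (≡.trans (to-cong (f-injective (to-injective eq))) (strictlyInverseˡ j))

  -- Makes the pigeonhole principle available on pairs, in particular on {0,1,2} × K.
  Fin×-count : ∀ m → Inverse (≡.setoid (Fin m) ×ₛ S) (≡.setoid (Fin (m ℕ.* n)))
  Fin×-count m = record
    { to        = λ (i , x) → combine i (to x)
    ; from      = λ k → map₂ from (remQuot n k)
    ; to-cong   = λ (i≡j , x≈y) → ≡.cong₂ combine i≡j (to-cong x≈y)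
    ; from-cong = λ { ≡.refl → ≡.refl , refl }
    ; inverse   =
        (λ { {k} (eq₁ , eq₂) → ≡.trans
          (≡.cong₂ combine eq₁ (inverseˡ eq₂)) (combine-remQuot {m} n k) })
      , (λ { {i , x} ≡.refl →
          let eq = remQuot-combine i (to x) in
          ≡.cong proj₁ eq , trans (from-cong (≡.cong proj₂ eq)) (strictlyInverseʳ x) })
    }

-- Arithmetic in a finite field.

module FieldProperties {c ℓ q} (K : FiniteField c ℓ q) where

  open Weierstrass K hiding (zero)
  open Inverse enumeration using (to; from; to-cong; strictlyInverseˡ; strictlyInverseʳ)
  open IntegerCoefficients commutativeRing
    using (Polynomial; solve; _:=_; _:+_; _:*_; _:-_; _:^_; _:×_; con)
  open import Algebra.Properties.CommutativeSemiring.Exp commutativeSemiring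
    using (^-congˡ; ^-distrib-*)
  open import Algebra.Properties.Group +-group using (x∙y⁻¹≈ε⇒x≈y; x≈y⇒x∙y⁻¹≈ε)
  open import Relation.Binary.Reasoning.Setoid setoid

  ⁻¹-inverseʳ : ∀ {x} → x ≉ 0# → x * x ⁻¹ ≈ 1#
  ⁻¹-inverseʳ {x} x≉0 with x ≟ 0#
  ... | yes x≈0 = contradiction x≈0 x≉0
  ... | no  x≉0 = proj₂ (proj₂ (≉0⇒invertible x x≉0))

  *-cancelˡ : ∀ {x y z} → x ≉ 0# → x * y ≈ x * z → y ≈ z
  *-cancelˡ {x} {y} {z} x≉0 xy≈xz = begin
    y              ≈⟨ unfold y ⟩
    x ⁻¹ * (x * y) ≈⟨ *-congˡ xy≈xz ⟩
    x ⁻¹ * (x * z) ≈⟨ unfold z ⟨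
    z              ∎
    where
    unfold : ∀ w → w ≈ x ⁻¹ * (x * w)
    unfold w = begin
      w              ≈⟨ *-identityˡ w ⟨
      1# * w         ≈⟨ *-congʳ (⁻¹-inverseʳ x≉0) ⟨
      x * x ⁻¹ * w   ≈⟨ solve 3 (λ a b w → a :* b :* w := b :* (a :* w)) refl x (x ⁻¹) w ⟩
      x ⁻¹ * (x * w) ∎

  zero-product : ∀ {x y} → x * y ≈ 0# → x ≈ 0# ⊎ y ≈ 0#
  zero-product {x} {y} xy≈0 with x ≟ 0#
  ... | yes x≈0 = inj₁ x≈0
  ... | no  x≉0 = inj₂ (*-cancelˡ x≉0 (trans xy≈0 (sym (zeroʳ x))))

  *-≉0 : ∀ {x y} → x ≉ 0# → y ≉ 0# → x * y ≉ 0#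
  *-≉0 x≉0 y≉0 = [ x≉0 , y≉0 ]′ ∘ zero-product

  ^-≉0 : ∀ {x} → x ≉ 0# → ∀ n → x ^ n ≉ 0#
  ^-≉0 x≉0 ℕ.zero    = 1≉0
  ^-≉0 x≉0 (ℕ.suc n) = *-≉0 x≉0 (^-≉0 x≉0 n)

  0³≈0 : 0# ^ 3 ≈ 0#
  0³≈0 = zeroˡ _

  IsCube-quotient : ∀ {x u v} → v ≉ 0# → x * v ^ 3 ≈ u ^ 3 → IsCube x
  IsCube-quotient {x} {u} {v} v≉0 xv³≈u³ = u * v ⁻¹ , (begin
    (u * v ⁻¹) ^ 3             ≈⟨ ^-distrib-* u (v ⁻¹) 3 ⟩
    u ^ 3 * (v ⁻¹) ^ 3         ≈⟨ *-congʳ xv³≈u³ ⟨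
    x * v ^ 3 * (v ⁻¹) ^ 3     ≈⟨ trans (*-congˡ (^-distrib-* v (v ⁻¹) 3)) (sym (*-assoc _ _ _)) ⟨
    x * (v * v ⁻¹) ^ 3         ≈⟨ *-congˡ (^-congˡ 3 (⁻¹-inverseʳ v≉0)) ⟩
    x * 1# ^ 3                 ≈⟨ solve 1 (λ x → x :* con (+ 1) :^ 3 := x) refl x ⟩
    x                          ∎)

  -- Disjointness of the cosets of the cubes.

  module _ {b} (b-noncube : ¬ IsCube b) where

    noncube-≉0 : b ≉ 0#
    noncube-≉0 b≈0 = b-noncube (0# , trans 0³≈0 (sym b≈0))

    -- A relation between two different cosets would make `b` a quotient of cubes: directly for
    -- exponents 0 and 1, after multiplying by `b` for 0 and 2 (as `b * b ^ 2` is a cube), after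
    -- cancelling `b` for 1 and 2.
    cosets-disjoint : ∀ (i j : Fin 3) {u v} → u ≉ 0# → v ≉ 0# →
      b ^ toℕ i * u ^ 3 ≈ b ^ toℕ j * v ^ 3 → i ≡ j
    cosets-disjoint zero zero _ _ _ = ≡.refl
    cosets-disjoint zero (suc zero) {u} {v} u≉0 v≉0 eq = contradiction
      (IsCube-quotient v≉0 (begin
        b * v ^ 3      ≈⟨ *-congʳ (*-identityʳ b) ⟨
        b ^ 1 * v ^ 3  ≈⟨ eq ⟨
        1# * u ^ 3     ≈⟨ *-identityˡ _ ⟩
        u ^ 3          ∎)) b-noncube
    cosets-disjoint zero (suc (suc zero)) {u} {v} u≉0 v≉0 eq = contradiction
      (IsCube-quotient u≉0 (begin
        b * u ^ 3            ≈⟨ *-congˡ (*-identityˡ _) ⟨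
        b * (1# * u ^ 3)     ≈⟨ *-congˡ eq ⟩
        b * (b ^ 2 * v ^ 3)  ≈⟨ solve 2 (λ b v → b :* (b :^ 2 :* v :^ 3) := (b :* v) :^ 3) refl b v ⟩
        (b * v) ^ 3          ∎)) b-noncube
    cosets-disjoint (suc zero) (suc zero) _ _ _ = ≡.refl
    cosets-disjoint (suc zero) (suc (suc zero)) {u} {v} u≉0 v≉0 eq = contradiction
      (IsCube-quotient v≉0 (*-cancelˡ noncube-≉0 (begin
        b * (b * v ^ 3)  ≈⟨ solve 2 (λ b w → b :* (b :* w) := b :^ 2 :* w) refl b (v ^ 3) ⟩
        b ^ 2 * v ^ 3    ≈⟨ eq ⟨
        b ^ 1 * u ^ 3    ≈⟨ *-congʳ (*-identityʳ b) ⟩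
        b * u ^ 3        ∎))) b-noncube
    cosets-disjoint (suc (suc zero)) (suc (suc zero)) _ _ _ = ≡.refl
    cosets-disjoint i@(suc zero)       j@zero       u≉0 v≉0 = ≡.sym ∘ cosets-disjoint j i v≉0 u≉0 ∘ sym
    cosets-disjoint i@(suc (suc zero)) j@zero       u≉0 v≉0 = ≡.sym ∘ cosets-disjoint j i v≉0 u≉0 ∘ sym
    cosets-disjoint i@(suc (suc zero)) j@(suc zero) u≉0 v≉0 = ≡.sym ∘ cosets-disjoint j i v≉0 u≉0 ∘ sym

  -- Fibres of the cubing map.

  cubing-injective : (∀ x → x ^ 3 ≈ 1# → x ≈ 1#) → Injective _≈_ _≈_ (_^ 3)
  cubing-injective trivial {x} {y} x³≈y³ with y ≟ 0#
  ... | yes y≈0 with x ≟ 0#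
  ...   | yes x≈0 = trans x≈0 (sym y≈0)
  ...   | no  x≉0 = contradiction (trans x³≈y³ (trans (^-congˡ 3 y≈0) 0³≈0)) (^-≉0 x≉0 3)
  cubing-injective trivial {x} {y} x³≈y³ | no y≉0 = begin
    x               ≈⟨ *-identityʳ x ⟨
    x * 1#          ≈⟨ *-congˡ (⁻¹-inverseʳ y≉0) ⟨
    x * (y * y ⁻¹)  ≈⟨ solve 3 (λ x y z → x :* (y :* z) := x :* z :* y) refl x y (y ⁻¹) ⟩
    x * y ⁻¹ * y    ≈⟨ *-congʳ (trivial _ (begin
      (x * y ⁻¹) ^ 3        ≈⟨ ^-distrib-* x (y ⁻¹) 3 ⟩
      x ^ 3 * (y ⁻¹) ^ 3    ≈⟨ *-congʳ x³≈y³ ⟩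
      y ^ 3 * (y ⁻¹) ^ 3    ≈⟨ ^-distrib-* y (y ⁻¹) 3 ⟨
      (y * y ⁻¹) ^ 3        ≈⟨ ^-congˡ 3 (⁻¹-inverseʳ y≉0) ⟩
      1# ^ 3                ≈⟨ solve 0 (con (+ 1) :^ 3 := con (+ 1)) refl ⟩
      1#                    ∎)) ⟩
    1# * y          ≈⟨ *-identityˡ y ⟩
    y               ∎

  -- The polynomial x³ - y³ factors as (x - y)(x - ωy)(x - ω²y), and a field has no zero divisors.
  cube-roots : ∀ {ω} → ω ^ 3 ≈ 1# → ω ≉ 1# →
    ∀ {x y} → x ^ 3 ≈ y ^ 3 → ∃ λ (j : Fin 3) → x ≈ ω ^ toℕ j * y
  cube-roots {ω} ω³≈1 ω≉1 {x} {y} x³≈y³ =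
    [ root zero , [ root (suc zero) , root (suc (suc zero)) ]′ ∘ zero-product ]′ (zero-product product≈0)
    where
    root : ∀ j → x - ω ^ toℕ j * y ≈ 0# → ∃ λ (j : Fin 3) → x ≈ ω ^ toℕ j * y
    root j eq = j , x∙y⁻¹≈ε⇒x≈y _ _ eq

    1+ω+ω²≈0 : 1# + ω + ω ^ 2 ≈ 0#
    1+ω+ω²≈0 = fromInj₂ (λ ω-1≈0 → contradiction (x∙y⁻¹≈ε⇒x≈y _ _ ω-1≈0) ω≉1)
      (zero-product (begin
        (ω - 1#) * (1# + ω + ω ^ 2)
          ≈⟨ solve 1 (λ ω →
               (ω :- con (+ 1)) :* (con (+ 1) :+ ω :+ ω :^ 2) := ω :^ 3 :- con (+ 1)) refl ω ⟩
        ω ^ 3 - 1#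
          ≈⟨ x≈y⇒x∙y⁻¹≈ε ω³≈1 ⟩
        0# ∎))

    product≈0 : (x - ω ^ 0 * y) * ((x - ω ^ 1 * y) * (x - ω ^ 2 * y)) ≈ 0#
    product≈0 = begin
      (x - ω ^ 0 * y) * ((x - ω ^ 1 * y) * (x - ω ^ 2 * y))
        -- The solver does not know the relations on `ω`, so the correction terms appear as explicit
        -- multiples of `ω ^ 3 - 1#` and `1# + ω + ω ^ 2`, both of which vanish.
        ≈⟨ solve 3 (λ x y ω →
             (x :- ω :^ 0 :* y) :* ((x :- ω :^ 1 :* y) :* (x :- ω :^ 2 :* y)) :=
             (x :^ 3 :- y :^ 3) :+ (x :- y) :*
               ((ω :^ 3 :- con (+ 1)) :* y :^ 2 :- (con (+ 1) :+ ω :+ ω :^ 2) :* (x :* y)))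
             refl x y ω ⟩
      (x ^ 3 - y ^ 3) + (x - y) * ((ω ^ 3 - 1#) * y ^ 2 - (1# + ω + ω ^ 2) * (x * y))
        ≈⟨ +-cong (x≈y⇒x∙y⁻¹≈ε x³≈y³) (*-congˡ (+-cong
             (*-congʳ (x≈y⇒x∙y⁻¹≈ε ω³≈1)) (-‿cong (*-congʳ 1+ω+ω²≈0)))) ⟩
      0# + (x - y) * (0# * y ^ 2 - 0# * (x * y))
        ≈⟨ solve 2 (λ x y →
             con (+ 0) :+ (x :- y) :* (con (+ 0) :* y :^ 2 :- con (+ 0) :* (x :* y)) := con (+ 0))
             refl x y ⟩
      0# ∎

  private
    -- The search takes an index rather than a field element, so the chosen root depends only on the
    -- class of the element under `_≈_`. Non-cubes get the default `0#`.
    rootᶠ : Fin q → Carrier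
    rootᶠ i with any? (λ j → from j ^ 3 ≟ from i)
    ... | yes (j , _) = from j
    ... | no  _       = 0#

    rootᶠ-cube : ∀ i {x} → x ^ 3 ≈ from i → rootᶠ i ^ 3 ≈ from i
    rootᶠ-cube i {x} x³≈i with any? (λ j → from j ^ 3 ≟ from i)
    ... | yes (_ , eq) = eq
    ... | no  none     = contradiction (to x , trans (^-congˡ 3 (strictlyInverseʳ x)) x³≈i) none

  cubeRoot : Carrier → Carrier
  cubeRoot x = rootᶠ (to x)

  cubeRoot-cong : ∀ {x y} → x ≈ y → cubeRoot x ≈ cubeRoot y
  cubeRoot-cong x≈y = reflexive (≡.cong rootᶠ (to-cong x≈y))

  cubeRoot-cube : ∀ x → x ^ 3 ≈ cubeRoot (x ^ 3) ^ 3
  cubeRoot-cube x = sym (trans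
    (rootᶠ-cube (to (x ^ 3)) (sym (strictlyInverseʳ (x ^ 3)))) (strictlyInverseʳ (x ^ 3)))

  -- Covering K* by three cosets, by counting.

  module _ (log : Carrier → Fin 3)
    (log-separates : ∀ {x y} → x ^ 3 ≈ y ^ 3 → log x ≡ log y → x ≈ y)
    {b} (b-noncube : ¬ IsCube b) where

    private
      -- Scaling x = 0 by bⁱ would lose i, so (i , 0) is fixed instead.
      ψ : Fin 3 × Carrier → Fin 3 × Carrier
      ψ (i , x) with x ≟ 0#
      ... | yes _ = i , 0#
      ... | no  _ = log x , b ^ toℕ i * x ^ 3

      bⁱ≉0 : ∀ (i : Fin 3) → b ^ toℕ i ≉ 0#
      bⁱ≉0 i = ^-≉0 (noncube-≉0 b-noncube) (toℕ i)

      -- The second component of `ψ` vanishes exactly when `x` does, so the two branches cannot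
      -- collide. For nonzero arguments disjointness of cosets gives `i ≡ j`; cancelling the power
      -- of `b` gives equal cubes, and `log` tells these apart.
      ψ-injective : let open Setoid (≡.setoid (Fin 3) ×ₛ setoid) using () renaming (_≈_ to _≋_)
        in Injective _≋_ _≋_ ψ
      ψ-injective {i , x} {j , y} eq with x ≟ 0# | y ≟ 0#
      ψ-injective (i≡j , _) | yes x≈0 | yes y≈0 = i≡j , trans x≈0 (sym y≈0)
      ψ-injective {y = j , _} (_ , eq) | yes _ | no y≉0 =
        contradiction (sym eq) (*-≉0 (bⁱ≉0 j) (^-≉0 y≉0 3))
      ψ-injective {i , _} (_ , eq) | no x≉0 | yes _ =
        contradiction eq (*-≉0 (bⁱ≉0 i) (^-≉0 x≉0 3))
      ψ-injective {i , x} {j , y} (log≡ , eq) | no x≉0 | no y≉0 =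
        i≡j , log-separates (*-cancelˡ (bⁱ≉0 j) (trans (*-congʳ bʲ≈bⁱ) eq)) log≡
        where
        i≡j : i ≡ j
        i≡j = cosets-disjoint b-noncube i j x≉0 y≉0 eq

        bʲ≈bⁱ : b ^ toℕ j ≈ b ^ toℕ i
        bʲ≈bⁱ = reflexive (≡.cong (λ k → b ^ toℕ k) (≡.sym i≡j))

      ψ-hit : ∀ {a} → a ≉ 0# → ∀ i x → proj₂ (ψ (i , x)) ≈ a →
        ∃ λ (i : Fin 3) → ∃ λ x → x ≉ 0# × b ^ toℕ i * x ^ 3 ≈ a
      ψ-hit a≉0 i x eq with x ≟ 0#
      ... | yes _   = contradiction (sym eq) a≉0
      ... | no  x≉0 = i , x , x≉0 , eq

    cosets-cover-log : ∀ {a} → a ≉ 0# →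
      ∃ λ (i : Fin 3) → ∃ λ x → x ≉ 0# × b ^ toℕ i * x ^ 3 ≈ a
    cosets-cover-log {a} a≉0 =
      let (i , x) , _ , eq =
            -- Any first component would serve as target: the coset representation is read off the
            -- second.
            injective⇒surjective (Fin×-count enumeration 3) ψ-injective (zero , a)
      in ψ-hit a≉0 i x eq

  cosets-cover : ∀ {b} → ¬ IsCube b → ∀ {a} → a ≉ 0# →
    ∃ λ (i : Fin 3) → ∃ λ x → x ≉ 0# × b ^ toℕ i * x ^ 3 ≈ a
  cosets-cover with any? (λ i → (from i ^ 3 ≟ 1#) ×-dec ¬? (from i ≟ 1#))
  ... | yes (i , ω³≈1 , ω≉1) = cosets-cover-log (proj₁ ∘ log) log-separates
    where
    ω : Carrier
    ω = from i

    -- `x` and the chosen cube root of `x ^ 3` have the same cube, hence differ by a power of `ω`.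
    log : ∀ x → ∃ λ (j : Fin 3) → x ≈ ω ^ toℕ j * cubeRoot (x ^ 3)
    log x = cube-roots ω³≈1 ω≉1 (cubeRoot-cube x)

    log-separates : ∀ {x y} → x ^ 3 ≈ y ^ 3 → proj₁ (log x) ≡ proj₁ (log y) → x ≈ y
    log-separates {x} {y} x³≈y³ log≡ = begin
      x                                           ≈⟨ proj₂ (log x) ⟩
      ω ^ toℕ (proj₁ (log x)) * cubeRoot (x ^ 3)  ≈⟨ *-cong
        (reflexive (≡.cong (λ k → ω ^ toℕ k) log≡)) (cubeRoot-cong x³≈y³) ⟩
      ω ^ toℕ (proj₁ (log y)) * cubeRoot (y ^ 3)  ≈⟨ proj₂ (log y) ⟨
      y                                           ∎
  ... | no none = cosets-cover-log (λ _ → zero) (λ x³≈y³ _ → cubing-injective trivial x³≈y³)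
    where
    trivial : ∀ x → x ^ 3 ≈ 1# → x ≈ 1#
    trivial x x³≈1 with x ≟ 1#
    ... | yes x≈1 = x≈1
    ... | no  x≉1 = contradiction
      ( to x
      , trans (^-congˡ 3 (strictlyInverseʳ x)) x³≈1
      , x≉1 ∘ trans (sym (strictlyInverseʳ x))
      ) none

  -- Changes of variables to the form y² + axy + by = x³.

  module _ where
    open WeierstrassCurve

    -- The coefficient `a` is not prescribed: its equation `u * a ≈ a₁ + 2 · s` is solved by
    -- inverting `u`. The other four transformation formulas become the hypotheses.
    normal-form : ∀ E (u r s t b : Carrier) → u ≉ 0# →
      a₂ E - s * a₁ E + 3 · r - s ^ 2 ≈ 0# →
      u ^ 3 * b ≈ a₃ E + r * a₁ E + 2 · t →
      a₄ E - s * a₃ E + 2 · (r * a₂ E) - (t + r * s) * a₁ E + 3 · r ^ 2 - 2 · (s * t) ≈ 0# →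
      a₆ E + r * a₄ E + r ^ 2 * a₂ E + r ^ 3 - t * a₃ E - t ^ 2 - r * t * a₁ E ≈ 0# →
      ∃ λ a → E ≅ (y²+ a xy+ b y=x³)
    normal-form E u r s t b u≉0 a₂′≈0 a₃′≈ a₄′≈0 a₆′≈0 = u ⁻¹ * (a₁ E + 2 · s) , record
      { u = u ; r = r ; s = s ; t = t
      ; u≉0 = u≉0
      ; a₁-eq = trans (sym (*-assoc _ _ _)) (trans (*-congʳ (⁻¹-inverseʳ u≉0)) (*-identityˡ _))
      ; a₂-eq = trans (zeroʳ _) (sym a₂′≈0)
      ; a₃-eq = a₃′≈
      ; a₄-eq = trans (zeroʳ _) (sym a₄′≈0)
      ; a₆-eq = trans (zeroʳ _) (sym a₆′≈0)
      }

    scaling : ∀ a₁ a₃ {u b} → u ≉ 0# → u ^ 3 * b ≈ a₃ →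
      ∃ λ a → (y²+ a₁ xy+ a₃ y=x³) ≅ (y²+ a xy+ b y=x³)
    scaling a₁ a₃ {u} {b} u≉0 u³b≈a₃ = normal-form _ u 0# 0# 0# b u≉0
      (solve 1 (λ a₁ → o :- o :* a₁ :+ 3 :× o :- o :^ 2 := o) refl a₁)
      (trans u³b≈a₃ (solve 2 (λ a₁ a₃ → a₃ := a₃ :+ o :* a₁ :+ 2 :× o) refl a₁ a₃))
      (solve 2 (λ a₁ a₃ →
        o :- o :* a₃ :+ 2 :× (o :* o) :- (o :+ o :* o) :* a₁ :+ 3 :× (o :^ 2) :- 2 :× (o :* o) := o)
        refl a₁ a₃)
      (solve 2 (λ a₁ a₃ →
        o :+ o :* o :+ o :^ 2 :* o :+ o :^ 3 :- o :* a₃ :- o :^ 2 :- o :* o :* a₁ := o)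
        refl a₁ a₃)
      where
      o : ∀ {n} → Polynomial n
      o = con (+ 0)

    -- The discriminant of this family is `a₃ ^ 3 * (a₁ ^ 3 - 27 · a₃)`.
    elliptic⇒a₃≉0 : ∀ a₁ a₃ → IsElliptic (y²+ a₁ xy+ a₃ y=x³) → a₃ ≉ 0#
    elliptic⇒a₃≉0 a₁ a₃ Δ≉0 a₃≈0 = Δ≉0 (begin
      Δ (y²+ a₁ xy+ a₃ y=x³)
        ≈⟨ solve 2 (λ a₁ a₃ →
             let b₂ = a₁ :^ 2 :+ 4 :× con (+ 0)
                 b₄ = 2 :× con (+ 0) :+ a₁ :* a₃
                 b₆ = a₃ :^ 2 :+ 4 :× con (+ 0)
                 b₈ = a₁ :^ 2 :* con (+ 0) :+ 4 :× (con (+ 0) :* con (+ 0)) :- a₁ :* a₃ :* con (+ 0)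
                        :+ con (+ 0) :* a₃ :^ 2 :- con (+ 0) :^ 2
             in 9 :× (b₂ :* b₄ :* b₆) :- b₂ :^ 2 :* b₈ :- 8 :× (b₄ :^ 3) :- 27 :× (b₆ :^ 2)
                := a₃ :* (a₃ :^ 2 :* (a₁ :^ 3 :- 27 :× a₃)))
             refl a₁ a₃ ⟩
      a₃ * (a₃ ^ 2 * (a₁ ^ 3 - 27 · a₃))
        ≈⟨ *-congʳ a₃≈0 ⟩
      0# * (a₃ ^ 2 * (a₁ ^ 3 - 27 · a₃))
        ≈⟨ zeroˡ _ ⟩
      0# ∎)

  -- Points of order 3 as flexes.

  module _ (E : WeierstrassCurve) where

    open WeierstrassCurve E

    -- Literally the slope in the last case of `add`, so that `double` can end in `≡.refl`.
    tangentSlope : Carrier → Carrier → Carrier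
    tangentSlope x y =
      (3 · x ^ 2 + 2 · (a₂ * x) + a₄ - a₁ * y) * (2 · y + a₁ * x + a₃) ⁻¹

    add≡𝒪⇒x₁≈x₂ : ∀ {x₁ y₁ x₂ y₂} → add E (affine x₁ y₁) (affine x₂ y₂) ≡ 𝒪 → x₁ ≈ x₂
    add≡𝒪⇒x₁≈x₂ {x₁} {y₁} {x₂} {y₂} eq with x₁ ≟ x₂ | y₁ + y₂ + a₁ * x₂ + a₃ ≟ 0#
    -- For different abscissas `add` returns an affine point, which makes `eq` absurd; only this
    -- case remains.
    ... | yes x₁≈x₂ | _ = x₁≈x₂

    double : ∀ {x y} → add E (affine x y) (affine x y) ≡.≢ 𝒪 →
      2 · y + a₁ * x + a₃ ≉ 0# ×
      add E (affine x y) (affine x y) ≡ thirdPoint E (tangentSlope x y) x y x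
    double {x} {y} 2P≢𝒪 with x ≟ x | y + y + a₁ * x + a₃ ≟ 0#
    ... | no  x≉x | _       = contradiction refl x≉x
    ... | yes _   | yes _   = contradiction ≡.refl 2P≢𝒪
    ... | yes _   | no  d≉0 = d≉0 ∘ trans
      (solve 4 (λ x y a₁ a₃ → y :+ y :+ a₁ :* x :+ a₃ := 2 :× y :+ a₁ :* x :+ a₃) refl x y a₁ a₃) , ≡.refl

    -- Since 2P is not `𝒪`, the tangent at P is not vertical and 2P is given by the tangent formula.
    -- Then P + 2P = `𝒪` forces the abscissas of P and 2P to agree.
    order-3⇒flex : ∀ {x y} → HasOrder E (affine x y) 3 →
      2 · y + a₁ * x + a₃ ≉ 0# ×
      x ≈ tangentSlope x y ^ 2 + a₁ * tangentSlope x y - a₂ - x - x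
    order-3⇒flex {x} {y} (_ , 3P≡𝒪 , minimal) =
      let d≉0 , 2P≡ = double (minimal 2 (ℕ.s≤s ℕ.z≤n) (ℕ.s≤s (ℕ.s≤s (ℕ.s≤s ℕ.z≤n))))
      in d≉0 , add≡𝒪⇒x₁≈x₂ (≡.trans (≡.sym (≡.cong (add E (affine x y)) 2P≡)) 3P≡𝒪)

    order-3-normal-form : (∀ x → IsCube x) → ∀ {P} → OnCurve E P → HasOrder E P 3 →
      ∃ λ a → E ≅ (y²+ a xy+ 1# y=x³)
    order-3-normal-form _ {𝒪} _ (_ , _ , minimal) =
      -- `𝒪` has order 1, against minimality of 3.
      contradiction ≡.refl (minimal 1 (ℕ.s≤s ℕ.z≤n) (ℕ.s≤s (ℕ.s≤s ℕ.z≤n)))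
    order-3-normal-form cubes {affine x y} onCurve order =
      -- Taking `r = x`, `t = y` moves P to the origin, which kills a₆ as P lies on the curve; the
      -- tangent slope `s` kills a₄, and the flex condition kills a₂. The new a₃ is `d` before
      -- scaling, and a cube root `u` of `d` scales it to `1#`.
      normal-form E u x s y 1# u≉0 a₂′≈0 a₃′≈ a₄′≈0 a₆′≈0
      where
      s d n u : Carrier
      s = tangentSlope x y
      d = 2 · y + a₁ * x + a₃
      n = 3 · x ^ 2 + 2 · (a₂ * x) + a₄ - a₁ * y
      u = proj₁ (cubes d)

      d≉0 : d ≉ 0#
      d≉0 = proj₁ (order-3⇒flex order)

      flex : x ≈ s ^ 2 + a₁ * s - a₂ - x - x
      flex = proj₂ (order-3⇒flex order)

      u³≈d : u ^ 3 ≈ d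
      u³≈d = proj₂ (cubes d)

      u≉0 : u ≉ 0#
      u≉0 u≈0 = d≉0 (trans (sym u³≈d) (trans (^-congˡ 3 u≈0) 0³≈0))

      sd≈n : s * d ≈ n
      sd≈n = begin
        n * d ⁻¹ * d    ≈⟨ solve 3 (λ n d e → n :* e :* d := n :* (d :* e)) refl n d (d ⁻¹) ⟩
        n * (d * d ⁻¹)  ≈⟨ *-congˡ (⁻¹-inverseʳ d≉0) ⟩
        n * 1#          ≈⟨ *-identityʳ n ⟩
        n               ∎

      a₂′≈0 : a₂ - s * a₁ + 3 · x - s ^ 2 ≈ 0#
      a₂′≈0 = trans
        (solve 4 (λ a₁ a₂ x s → a₂ :- s :* a₁ :+ 3 :× x :- s :^ 2 :=
          x :- (s :^ 2 :+ a₁ :* s :- a₂ :- x :- x)) refl a₁ a₂ x s)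
        (x≈y⇒x∙y⁻¹≈ε flex)

      a₃′≈ : u ^ 3 * 1# ≈ a₃ + x * a₁ + 2 · y
      a₃′≈ = trans (*-identityʳ _) (trans u³≈d
        (solve 4 (λ a₁ a₃ x y → 2 :× y :+ a₁ :* x :+ a₃ := a₃ :+ x :* a₁ :+ 2 :× y) refl a₁ a₃ x y))

      a₄′≈0 : a₄ - s * a₃ + 2 · (x * a₂) - (y + x * s) * a₁ + 3 · x ^ 2 - 2 · (s * y) ≈ 0#
      a₄′≈0 = trans
        (solve 7 (λ a₁ a₂ a₃ a₄ x y s →
          a₄ :- s :* a₃ :+ 2 :× (x :* a₂) :- (y :+ x :* s) :* a₁ :+ 3 :× (x :^ 2) :- 2 :× (s :* y) :=
          (3 :× (x :^ 2) :+ 2 :× (a₂ :* x) :+ a₄ :- a₁ :* y) :- s :* (2 :× y :+ a₁ :* x :+ a₃))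
          refl a₁ a₂ a₃ a₄ x y s)
        (x≈y⇒x∙y⁻¹≈ε (sym sd≈n))

      a₆′≈0 : a₆ + x * a₄ + x ^ 2 * a₂ + x ^ 3 - y * a₃ - y ^ 2 - x * y * a₁ ≈ 0#
      a₆′≈0 = trans
        (solve 7 (λ a₁ a₂ a₃ a₄ a₆ x y →
          a₆ :+ x :* a₄ :+ x :^ 2 :* a₂ :+ x :^ 3 :- y :* a₃ :- y :^ 2 :- x :* y :* a₁ :=
          (x :^ 3 :+ a₂ :* x :^ 2 :+ a₄ :* x :+ a₆) :- (y :^ 2 :+ a₁ :* x :* y :+ a₃ :* y))
          refl a₁ a₂ a₃ a₄ a₆ x y)
        (x≈y⇒x∙y⁻¹≈ε (sym onCurve))

-- Fermat's little theorem, and cubes when q ≡ -1 mod 3.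

module Fermat {c ℓ n} (K : FiniteField c ℓ (ℕ.suc n)) where

  open Weierstrass K hiding (zero)
  open FieldProperties K
  open Inverse enumeration using (to; from; to-cong; strictlyInverseˡ; strictlyInverseʳ)
  open import Algebra.Properties.CommutativeMonoid.Sum *-commutativeMonoid
    using (sum-replicate; sum-permute; sum-cong-≋; ∑-distrib-+) renaming (sum to ∏)
  open import Algebra.Properties.Semiring.Exp semiring using (^-assocʳ)
  open import Relation.Binary.Reasoning.Setoid setoid

  private
    i₀ = to 0#

    -- `punchIn i₀` skips the index of `0#`, so this enumerates K*.
    nonzero : Fin n → Carrier
    nonzero k = from (punchIn i₀ k)

    nonzero-≉0 : ∀ k → nonzero k ≉ 0#
    nonzero-≉0 k eq = punchInᵢ≢i i₀ k (≡.trans (≡.sym (strictlyInverseˡ _)) (to-cong eq))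

  ∏-≉0 : ∀ {m} (f : Fin m → Carrier) → (∀ k → f k ≉ 0#) → ∏ f ≉ 0#
  ∏-≉0 {ℕ.zero}  f f≉0 = 1≉0
  ∏-≉0 {ℕ.suc m} f f≉0 = *-≉0 (f≉0 zero) (∏-≉0 (f ∘ suc) (f≉0 ∘ suc))

  module _ {a} (a≉0 : a ≉ 0#) where

    private
      -- Multiplication by `a`, transported to indices. It fixes `i₀`, so removing that index leaves
      -- a permutation of K*.
      π : Permutation (ℕ.suc n) (ℕ.suc n)
      π = permutation (λ i → to (a * from i)) (λ i → to (a ⁻¹ * from i))
        (λ i → ≡.trans (to-cong (cancel (⁻¹-inverseʳ a≉0) i)) (strictlyInverseˡ i))
        (λ i → ≡.trans (to-cong (cancel (trans (*-comm _ _) (⁻¹-inverseʳ a≉0)) i)) (strictlyInverseˡ i))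
        where
        cancel : ∀ {x y} → x * y ≈ 1# → ∀ i → x * from (to (y * from i)) ≈ from i
        cancel {x} {y} xy≈1 i = begin
          x * from (to (y * from i)) ≈⟨ *-congˡ (strictlyInverseʳ _) ⟩
          x * (y * from i)           ≈⟨ *-assoc _ _ _ ⟨
          x * y * from i             ≈⟨ *-congʳ xy≈1 ⟩
          1# * from i                ≈⟨ *-identityˡ _ ⟩
          from i                     ∎

      π-i₀ : π ⟨$⟩ʳ i₀ ≡ i₀
      π-i₀ = to-cong (trans (*-congˡ (strictlyInverseʳ 0#)) (zeroʳ a))

      nonzero-permute : ∀ k → nonzero (remove i₀ π ⟨$⟩ʳ k) ≈ a * nonzero k
      nonzero-permute k = begin
        from (punchIn i₀ (remove i₀ π ⟨$⟩ʳ k))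
          ≡⟨ ≡.cong (λ i → from (punchIn i (remove i₀ π ⟨$⟩ʳ k))) π-i₀ ⟨
        from (punchIn (π ⟨$⟩ʳ i₀) (remove i₀ π ⟨$⟩ʳ k))
          ≡⟨ ≡.cong from (punchIn-permute π i₀ k) ⟨
        from (to (a * nonzero k))
          ≈⟨ strictlyInverseʳ _ ⟩
        a * nonzero k ∎

    -- Multiplication by `a` permutes K*, so it preserves the product of all nonzero elements while
    -- multiplying it by `a ^ n`.
    fermat : a ^ n ≈ 1#
    fermat = *-cancelˡ (∏-≉0 nonzero nonzero-≉0) (begin
      ∏ nonzero * a ^ n                  ≈⟨ *-comm _ _ ⟩
      -- The sum lemmas are read in the multiplicative monoid, where a repeated sum is a power.
      a ^ n * ∏ nonzero                  ≈⟨ *-congʳ (sum-replicate n) ⟨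
      ∏ {n} (λ _ → a) * ∏ nonzero        ≈⟨ ∑-distrib-+ (λ _ → a) nonzero ⟨
      ∏ (λ k → a * nonzero k)            ≈⟨ sum-cong-≋ nonzero-permute ⟨
      ∏ (λ k → nonzero (remove i₀ π ⟨$⟩ʳ k)) ≈⟨ sum-permute nonzero (remove i₀ π) ⟨
      ∏ nonzero                          ≈⟨ *-identityʳ _ ⟨
      ∏ nonzero * 1#                     ∎)

  all-cubes : ∀ {m} → n ≡ ℕ.suc (m ℕ.* 3) → ∀ a → IsCube a
  all-cubes {m} n≡1+3m a with a ≟ 0#
  ... | yes a≈0 = 0# , trans 0³≈0 (sym a≈0)
  ... | no  a≉0 = IsCube-quotient {u = 1#} (^-≉0 a≉0 m) (begin
    a * (a ^ m) ^ 3       ≈⟨ *-congˡ (^-assocʳ a m 3) ⟩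
    a ^ ℕ.suc (m ℕ.* 3)   ≡⟨ ≡.cong (a ^_) n≡1+3m ⟨
    a ^ n                 ≈⟨ fermat a≉0 ⟩
    1#                    ≈⟨ 1³≈1 ⟨
    1# ^ 3                ∎)
    where
    1³≈1 : 1# ^ 3 ≈ 1#
    1³≈1 = trans (*-identityˡ _) (trans (*-identityˡ _) (*-identityˡ _))

q≡-1[3]⇒all-cubes : ∀ {c ℓ q} (K : FiniteField c ℓ q) → let open Weierstrass K in
  3 ∣ q ℕ.+ 1 → ∀ a → IsCube a
-- A field with no elements is excluded by the index of `a` in `Fin 0`.
q≡-1[3]⇒all-cubes {q = ℕ.zero} K _ a with () ← Inverse.to (FiniteField.enumeration K) a
q≡-1[3]⇒all-cubes {q = ℕ.suc n} K (divides ℕ.zero ())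
q≡-1[3]⇒all-cubes {q = ℕ.suc n} K (divides (ℕ.suc m) eq) =
  -- Here `eq` says n + 2 = 3 + 3m; removing two successors leaves n = 1 + 3m.
  Fermat.all-cubes K {m} (ℕ.suc-injective (≡.trans (ℕ.+-comm 1 n) (ℕ.suc-injective eq)))

lemma1 : ∀ {c ℓ} {q : ℕ} (K : FiniteField c ℓ q) → let open Weierstrass K in
    ((a₁ a₃ : Carrier) → IsElliptic (y²+ a₁ xy+ a₃ y=x³) →
    (IsCube a₃ → ∃ λ a → (y²+ a₁ xy+ a₃ y=x³) ≅ (y²+ a xy+ 1# y=x³))
    ×
    (¬ IsCube a₃ → (b₀ : Carrier) → ¬ IsCube b₀ →
    (∃ λ a → (y²+ a₁ xy+ a₃ y=x³) ≅ (y²+ a xy+ b₀ y=x³))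
    ⊎
    (∃ λ a → (y²+ a₁ xy+ a₃ y=x³) ≅ (y²+ a xy+ b₀ ^ 2 y=x³))))
    ×
    (3 ∣ q ℕ.+ 1 → (E : WeierstrassCurve) → IsElliptic E →
    (∃ λ P → OnCurve E P × HasOrder E P 3) →
    ∃ λ a → E ≅ (y²+ a xy+ 1# y=x³))
lemma1 K =
  (λ a₁ a₃ Δ≉0 →
      (λ (u , u³≈a₃) → scaling a₁ a₃
        (λ u≈0 → elliptic⇒a₃≉0 a₁ a₃ Δ≉0 (trans (sym u³≈a₃) (trans (^-congˡ 3 u≈0) 0³≈0)))
        (trans (*-identityʳ _) u³≈a₃))
    , λ a₃-noncube b₀ b₀-noncube → case cosets-cover b₀-noncube (elliptic⇒a₃≉0 a₁ a₃ Δ≉0) of λ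
      -- The exponent of `b₀` in the coset of `a₃` selects the normal form; exponent 0 would make
      -- `a₃` a cube.
      { (zero , u , _ , eq) → contradiction (u , trans (sym (*-identityˡ _)) eq) a₃-noncube
      ; (suc zero , u , u≉0 , eq) →
          inj₁ (scaling a₁ a₃ u≉0 (trans (*-comm _ _) (trans (*-congʳ (sym (*-identityʳ b₀))) eq)))
      ; (suc (suc zero) , u , u≉0 , eq) → inj₂ (scaling a₁ a₃ u≉0 (trans (*-comm _ _) eq))
      })
  , λ 3∣q+1 E _ (P , onCurve , order) →
      order-3-normal-form E (q≡-1[3]⇒all-cubes K 3∣q+1) onCurve order
  where
  open Weierstrass K hiding (zero)
  open FieldProperties K
  open import Algebra.Properties.Semiring.Exp semiring using (^-congˡ)
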